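{- Let $P\in\mathbb{Q}_{\ge0}^{N\times N}$ be the transition matrix of a reversible and ergodic Markov chain on $V$ with stationary distribution $\pi$ and mixing rate $t^*$. For the rotor-router model on a multidigraph for $P$, with any initial configuration, $$\left|\chi^{(T)}_w-\mu^{(T)}_w\right|\le\frac{3\pi_w}{\pi_{\min}}\,t^*\,\bar\Delta$$ for all $w\in V$ and $T\ge0$.
   Context: Let $V=\{1,\dots,N\}$ and let $P\in\mathbb{Q}_{\ge 0}^{N\times N}$ be an ergodic (irreducible, aperiodic) stochastic matrix with stationary distribution $\pi$; $\pi_{\min}=\min_v\pi_v$; reversible means $\pi_uP_{u,v}=\pi_vP_{v,u}$ for all $u,v$. For $v\in V$ let $\mathcal N(v)=\{u: P_{v,u}>0\}$. Total variation distance $d_{TV}(\xi,\zeta)=\frac12\|\xi-\zeta\|_1$; mixing time $\tau(\varepsilon)=\max_{v}\min\{t\ge0: d_{TV}(P^t_{v,\cdot},\pi)\le\varepsilon\}$; mixing rate $t^*=\tau(1/4)$. For each $v$ let $\bar\delta(v)$ be a positive integer with $\bar\delta(v)P_{v,u}\in\mathbb{Z}$ for all $u$, and $\bar\Delta=\max_v\bar\delta(v)$. The rotor router: $\sigma_v(0),\dots,\sigma_v(\bar\delta(v)-1)\in\mathcal N(v)$ is any sequence in which each $u\in\mathcal N(v)$ occurs exactly $\bar\delta(v)P_{v,u}$ times, extended by $\sigma_v(i)=\sigma_v(i\bmod\bar\delta(v))$. Write $I_{v,u}[z,z')=|\{j\in\{z,\dots,z'-1\}:\sigma_v(j)=u\}|$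 (zero if $z'\le z$). Given $\chi^{(0)}\in\mathbb{Z}_{\ge0}^N$, set $Z^{(t)}_{v,u}=I_{v,u}\big[\sum_{s=0}^{t-1}\chi^{(s)}_v,\sum_{s=0}^{t}\chi^{(s)}_v\big)$, $\chi^{(t+1)}_u=\sum_vZ^{(t)}_{v,u}$, $\mu^{(0)}=\chi^{(0)}$, $\mu^{(t)}=\mu^{(0)}P^t$. -}

module Defs where

open import Algebra.Bundles using (CommutativeRing)
open import Data.Empty using (⊥-elim)
open import Data.Fin.Base using (Fin; zero; suc)
import Data.Fin.Properties as Fin
open import Data.Integer.Base as ℤ using (ℤ; +_)
open import Data.List.Base using (applyUpTo; filter; length)
open import Data.Nat.Base as ℕ using (ℕ; zero; suc; NonZero; _%_)
open import Data.Nat.Divisibility using (_∣_)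
import Data.Nat.Properties as ℕ
open import Data.Product.Base using (Σ-syntax; ∃; ∃-syntax; _×_; _,_)
open import Data.Rational.Base as ℚ
  using (ℚ; 0ℚ; 1ℚ; ½; _+_; _*_; _-_; _⊓_; _≤_; _<_; _/_; ∣_∣)
import Data.Rational.Properties as ℚ
open import Data.Sum.Base using (inj₁; inj₂)
open import Data.Vec.Functional using (Vector; foldr; head; tail)
open import Relation.Binary.PropositionalEquality
  using (_≡_; refl; sym; trans; cong; cong₂; subst; subst₂)
open import Relation.Nullary.Decidable.Core using (yes; no)

open import Algebra.Properties.Semiring.Sum
  (CommutativeRing.semiring ℚ.+-*-commutativeRing) public
  using () renaming (sum to sumℚ)
open import Algebra.Properties.Semiring.Sum ℕ.+-*-semiring public
  using () renaming (sum to sumℕ)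

private variable
  N : ℕ

fromℕ : ℕ → ℚ
fromℕ n = + n / 1

minimum : .{{NonZero N}} → Vector ℚ N → ℚ
minimum {N = suc _} f = foldr _⊓_ (head f) (tail f)

-- Only applied to vectors indexed by the (nonempty) vertex set, so the base
-- value 0 never matters.
maximum : Vector ℕ N → ℕ
maximum = foldr ℕ._⊔_ 0

Matrix : ℕ → Set
Matrix N = Fin N → Fin N → ℚ

identity : Matrix N
identity u v with u Fin.≟ v
... | yes _ = 1ℚ
... | no  _ = 0ℚ

infixl 7 _⊡_ _⊠_
infixr 8 _^_

_⊡_ : Vector ℚ N → Matrix N → Vector ℚ N
(ξ ⊡ A) u = sumℚ (λ v → ξ v * A v u)

_⊠_ : Matrix N → Matrix N → Matrix N
(A ⊠ B) u = A u ⊡ B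

_^_ : Matrix N → ℕ → Matrix N
P ^ zero  = identity
P ^ suc t = (P ^ t) ⊠ P

record IsDistribution (ξ : Vector ℚ N) : Set where
  field
    nonneg : ∀ v → 0ℚ ≤ ξ v
    total  : sumℚ ξ ≡ 1ℚ

IsStochastic : Matrix N → Set
IsStochastic P = ∀ v → IsDistribution (P v)

IsIrreducible : Matrix N → Set
IsIrreducible P = ∀ u v → ∃[ t ] 0ℚ < (P ^ t) u v

-- d is the greatest common divisor of the possible return times to v.
record IsPeriod (P : Matrix N) (v : Fin N) (d : ℕ) : Set where
  field
    divides  : ∀ t → 1 ℕ.≤ t → 0ℚ < (P ^ t) v v → d ∣ t
    greatest : ∀ c → (∀ t → 1 ℕ.≤ t → 0ℚ < (P ^ t) v v → c ∣ t) → c ∣ d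

IsAperiodic : Matrix N → Set
IsAperiodic P = ∀ v → IsPeriod P v 1

record IsErgodic (P : Matrix N) : Set where
  field
    stochastic  : IsStochastic P
    irreducible : IsIrreducible P
    aperiodic   : IsAperiodic P

-- The unique real stationary distribution of an irreducible rational matrix
-- is itself rational, so nothing is lost by taking π over ℚ.
record IsStationary (P : Matrix N) (π : Vector ℚ N) : Set where
  field
    distribution : IsDistribution π
    invariant    : ∀ v → (π ⊡ P) v ≡ π v

IsReversible : Matrix N → Vector ℚ N → Set
IsReversible P π = ∀ u v → π u * P u v ≡ π v * P v u

dTV : Vector ℚ N → Vector ℚ N → ℚ
dTV ξ ζ = ½ * sumℚ (λ v → ∣ ξ v - ζ v ∣)

IsLeast : (ℕ → Set) → ℕ → Set
IsLeast Q t = Q t × (∀ s → Q s → t ℕ.≤ s)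

-- The graph of the mixing time τ(ε): m v is the minimum over t for the
-- starting vertex v, and τ is the maximum of these.
IsMixingTime : Matrix N → Vector ℚ N → ℚ → ℕ → Set
IsMixingTime {N} P π ε τ =
  Σ[ m ∈ Vector ℕ N ]
    (∀ v → IsLeast (λ t → dTV ((P ^ t) v) π ≤ ε) (m v)) × τ ≡ maximum m

IsMixingRate : Matrix N → Vector ℚ N → ℕ → Set
IsMixingRate P π = IsMixingTime P π (+ 1 / 4)

-- occurrences σ u z z′ is the number of j ∈ {z, …, z′ - 1} with σ j ≡ u; by
-- truncated subtraction it is 0 if z′ ≤ z.
occurrences : (ℕ → Fin N) → Fin N → ℕ → ℕ → ℕ
occurrences σ u z z′ =
  length (filter (λ j → σ j Fin.≟ u) (applyUpTo (z ℕ.+_) (z′ ℕ.∸ z)))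

-- The multidigraph has δ v * P v u parallel edges from v to u.
record Multidigraph (P : Matrix N) : Set where
  field
    δ           : Vector ℕ N
    {{δ-nonZero}} : ∀ {v} → NonZero (δ v)
    integral    : ∀ v u → ∃[ k ] fromℕ (δ v) * P v u ≡ k / 1

  Δ : ℕ
  Δ = maximum δ

record RotorRouter (P : Matrix N) (G : Multidigraph P) : Set where
  open Multidigraph G
  field
    σ         : Fin N → ℕ → Fin N
    neighbour : ∀ v i → i ℕ.< δ v → 0ℚ < P v (σ v i)
    balanced  : ∀ v u → 0ℚ < P v u →
                fromℕ (occurrences (σ v) u 0 (δ v)) ≡ fromℕ (δ v) * P v u
    periodic  : ∀ v i → σ v i ≡ σ v (i % δ v)

  module Run (χ₀ : Vector ℕ N) where

    -- departed t v is the sum of χ s v over s < t, so the two interval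
    -- endpoints in Z t are departed t v and departed (suc t) v.
    χ        : ℕ → Vector ℕ N
    departed : ℕ → Vector ℕ N
    Z        : ℕ → Fin N → Vector ℕ N

    χ zero    = χ₀
    χ (suc t) u = sumℕ (λ v → Z t v u)

    departed zero    v = 0
    departed (suc t) v = departed t v ℕ.+ χ t v

    Z t v u =
      occurrences (σ v) u (departed t v) (departed t v ℕ.+ χ t v)

μ : Matrix N → Vector ℕ N → ℕ → Vector ℚ N
μ P χ₀ t = (λ v → fromℕ (χ₀ v)) ⊡ (P ^ t)

πmin : .{{NonZero N}} → Vector ℚ N → ℚ
πmin = minimum

private
  sum-nonneg : (f : Vector ℚ N) → (∀ i → 0ℚ ≤ f i) → 0ℚ ≤ sumℚ f
  sum-nonneg {zero}  f p = ℚ.≤-refl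
  sum-nonneg {suc N} f p =
    ℚ.+-mono-≤ (p zero) (sum-nonneg (tail f) (λ i → p (suc i)))

  sum-nonpos : (f : Vector ℚ N) → (∀ i → f i ≤ 0ℚ) → sumℚ f ≤ 0ℚ
  sum-nonpos {zero}  f p = ℚ.≤-refl
  sum-nonpos {suc N} f p =
    ℚ.+-mono-≤ (p zero) (sum-nonpos (tail f) (λ i → p (suc i)))

  term≤sum : (f : Vector ℚ N) → (∀ i → 0ℚ ≤ f i) → ∀ i → f i ≤ sumℚ f
  term≤sum f p zero = subst (_≤ sumℚ f) (ℚ.+-identityʳ _)
    (ℚ.+-monoʳ-≤ (f zero) (sum-nonneg (tail f) (λ i → p (suc i))))
  term≤sum f p (suc i) = subst (_≤ sumℚ f) (ℚ.+-identityˡ _)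
    (ℚ.+-mono-≤ (p zero) (term≤sum (tail f) (λ j → p (suc j)) i))

  *-nonneg : ∀ {p q} → 0ℚ ≤ p → 0ℚ ≤ q → 0ℚ ≤ p * q
  *-nonneg {p} {q} 0≤p 0≤q = subst (_≤ p * q) (ℚ.*-zeroʳ p)
    (ℚ.*-monoˡ-≤-nonNeg p {{ℚ.nonNegative 0≤p}} 0≤q)

  *-pos : ∀ {p q} → 0ℚ < p → 0ℚ < q → 0ℚ < p * q
  *-pos {p} {q} 0<p 0<q = subst (_< p * q) (ℚ.*-zeroʳ p)
    (ℚ.*-monoʳ-<-pos p {{ℚ.positive 0<p}} 0<q)

  *-nonposˡ : ∀ {p q} → p ≤ 0ℚ → 0ℚ ≤ q → p * q ≤ 0ℚ
  *-nonposˡ {p} {q} p≤0 0≤q = subst (p * q ≤_) (ℚ.*-zeroˡ q)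
    (ℚ.*-monoʳ-≤-nonNeg q {{ℚ.nonNegative 0≤q}} p≤0)

  *-nonposʳ : ∀ {p q} → 0ℚ ≤ p → q ≤ 0ℚ → p * q ≤ 0ℚ
  *-nonposʳ {p} {q} 0≤p q≤0 = subst (p * q ≤_) (ℚ.*-zeroʳ p)
    (ℚ.*-monoˡ-≤-nonNeg p {{ℚ.nonNegative 0≤p}} q≤0)

  minimum-pos : .{{_ : NonZero N}} (f : Vector ℚ N) →
                (∀ i → 0ℚ < f i) → 0ℚ < minimum f
  minimum-pos {suc _} f p = go (tail f) (λ i → p (suc i))
    where
    go : ∀ {n} (g : Vector ℚ n) → (∀ i → 0ℚ < g i) →
         0ℚ < foldr _⊓_ (head f) g
    go {zero}  g q = p zero
    go {suc n} g q with ℚ.⊓-sel (g zero) (foldr _⊓_ (head f) (tail g))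
    ... | inj₁ eq = subst (0ℚ <_) (sym eq) (q zero)
    ... | inj₂ eq =
      subst (0ℚ <_) (sym eq) (go (tail g) (λ i → q (suc i)))

module _ {P : Matrix N} {π : Vector ℚ N}
         (ergodic : IsErgodic P) (stationary : IsStationary P π) where
  open IsErgodic ergodic
  open IsStationary stationary

  private
    P≥0 : ∀ u v → 0ℚ ≤ P u v
    P≥0 u = IsDistribution.nonneg (stochastic u)

    π≥0 : ∀ v → 0ℚ ≤ π v
    π≥0 = IsDistribution.nonneg distribution

    P^≥0 : ∀ t u v → 0ℚ ≤ (P ^ t) u v
    P^≥0 zero u v with u Fin.≟ v
    ... | yes _ = ℚ.nonNegative⁻¹ 1ℚ
    ... | no  _ = ℚ.≤-refl
    P^≥0 (suc t) u v =
      sum-nonneg _ (λ x → *-nonneg (P^≥0 t u x) (P≥0 x v))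

    -- No vertex of mass 0 is reachable from a vertex of positive mass.
    pull : ∀ t u v → 0ℚ < π u → π v ≤ 0ℚ → (P ^ t) u v ≤ 0ℚ
    pull zero u v 0<πu πv≤0 with u Fin.≟ v
    ... | yes refl = ⊥-elim (ℚ.<-irrefl refl (ℚ.<-≤-trans 0<πu πv≤0))
    ... | no  _    = ℚ.≤-refl
    pull (suc t) u v 0<πu πv≤0 = sum-nonpos _ step
      where
      step : ∀ x → (P ^ t) u x * P x v ≤ 0ℚ
      step x with 0ℚ ℚ.<? π x
      ... | no  ¬0<πx =
        *-nonposˡ (pull t u x 0<πu (ℚ.≮⇒≥ ¬0<πx)) (P≥0 x v)
      ... | yes 0<πx with 0ℚ ℚ.<? P x v
      ...   | no  ¬0<Pxv = *-nonposʳ (P^≥0 t u x) (ℚ.≮⇒≥ ¬0<Pxv)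
      ...   | yes 0<Pxv  = ⊥-elim (ℚ.<-irrefl refl (ℚ.<-≤-trans
        (*-pos 0<πx 0<Pxv)
        (ℚ.≤-trans
          (term≤sum _ (λ y → *-nonneg (π≥0 y) (P≥0 y v)) x)
          (subst (_≤ 0ℚ) (sym (invariant v)) πv≤0))))

  π-pos : ∀ v → 0ℚ < π v
  π-pos v with 0ℚ ℚ.<? π v
  ... | yes 0<πv  = 0<πv
  ... | no  ¬0<πv = ⊥-elim (ℚ.<-irrefl refl (ℚ.<-≤-trans
      (ℚ.positive⁻¹ 1ℚ)
      (subst (_≤ 0ℚ) (IsDistribution.total distribution)
        (sum-nonpos π nonpos))))
    where
    nonpos : ∀ u → π u ≤ 0ℚ
    nonpos u with 0ℚ ℚ.<? π u | irreducible u v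
    ... | no  ¬0<πu | _ = ℚ.≮⇒≥ ¬0<πu
    ... | yes 0<πu  | t , 0<Ptuv = ⊥-elim (ℚ.<-irrefl refl
      (ℚ.<-≤-trans 0<Ptuv (pull t u v 0<πu (ℚ.≮⇒≥ ¬0<πv))))

  -- Makes the quotient by πmin in the discrepancy bound meaningful.
  πmin-nonZero : .{{_ : NonZero N}} → ℚ.NonZero (πmin π)
  πmin-nonZero =
    ℚ.>-nonZero (minimum-pos π π-pos)

{-# OPTIONS --safe #-}
module Submission where

-- Write e T = χ T - μ T and ρ t = χ (t + 1) - χ t P, so that e T is the sum of
-- ρ t P^(T-t-1) over t < T. Full periods of the rotor of v serve u exactly in
-- proportion, and the remaining partial period errs by at most δ v P v u, so
-- ∣ ρ t u ∣ ≤ Δ Σ_v P v u. Since ρ t sums to 0, P^s may be replaced by its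
-- deviation P^s - π. By reversibility
-- π_min ∣ (ρ t P^s) w ∣ ≤ Δ π_w ‖ P^s(w, ·) - π ‖₁, and the norms on the right
-- sum over all s to at most 3 t*, because they halve every t* steps.

open import Defs
open import Algebra.Bundles using (CommutativeRing)
open import Data.Fin.Base using (Fin; zero; suc; toℕ)
import Data.Fin.Properties as Fin
import Data.Integer.Base as ℤ
import Data.Integer.Properties as ℤ
open import Data.List.Base using (applyUpTo; filter; length)
open import Data.Nat.Base as ℕ using (ℕ; zero; suc; NonZero)
import Data.Nat.Coprimality as Coprimality
import Data.Nat.DivMod as ℕ
import Data.Nat.Properties as ℕ
open import Data.Product.Base using (∃-syntax; _,_; proj₁; proj₂)
open import Data.Rational.Base
  using (ℚ; 0ℚ; 1ℚ; ½; _+_; _*_; _-_; -_; _÷_; _⊓_; 1/_; _≤_; _<_; ∣_∣; mkℚ)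
import Data.Rational.Base as ℚ
import Data.Rational.Properties as ℚ
open import Algebra.Properties.Semiring.Sum (CommutativeRing.semiring ℚ.+-*-commutativeRing)
  using (sum-cong-≗; sum-replicate-zero; ∑-distrib-+; ∑-comm; *-distribˡ-sum; *-distribʳ-sum)
open import Data.Rational.Solver using (module +-*-Solver)
open import Data.Sum.Base using (inj₁; inj₂)
open import Data.Vec.Functional using (Vector; foldr; head; tail)
open import Function.Base using (_∘_)
open import Relation.Binary.PropositionalEquality
open import Relation.Nullary.Decidable.Core using (yes; no)
open import Relation.Nullary.Negation.Core using (contradiction)

open +-*-Solver using (solve; _:=_; _:+_; _:*_; _:-_; :-_; con)

-- Order and absolute value on the rationals

*-nonneg : ∀ {p q} → 0ℚ ≤ p → 0ℚ ≤ q → 0ℚ ≤ p * q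
*-nonneg {p} {q} 0≤p 0≤q = subst (_≤ p * q) (ℚ.*-zeroʳ p)
  (ℚ.*-monoˡ-≤-nonNeg p {{ℚ.nonNegative 0≤p}} 0≤q)

*-monoˡ-≤ : ∀ {p q r} → 0ℚ ≤ p → q ≤ r → p * q ≤ p * r
*-monoˡ-≤ {p} 0≤p = ℚ.*-monoˡ-≤-nonNeg p {{ℚ.nonNegative 0≤p}}

*-monoʳ-≤ : ∀ {p q r} → 0ℚ ≤ p → q ≤ r → q * p ≤ r * p
*-monoʳ-≤ {p} 0≤p = ℚ.*-monoʳ-≤-nonNeg p {{ℚ.nonNegative 0≤p}}

∣p∣≤q : ∀ {p q} → p ≤ q → - p ≤ q → ∣ p ∣ ≤ q
∣p∣≤q {p} p≤q -p≤q with ℚ.∣p∣≡p∨∣p∣≡-p p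
... | inj₁ eq = subst (_≤ _) (sym eq) p≤q
... | inj₂ eq = subst (_≤ _) (sym eq) -p≤q

p-q≤r : ∀ {p q r} → p ≤ r → 0ℚ ≤ q → p - q ≤ r
p-q≤r {p} {q} {r} p≤r 0≤q = subst (p - q ≤_) (ℚ.+-identityʳ r)
  (ℚ.+-mono-≤ p≤r (ℚ.neg-antimono-≤ 0≤q))

-- Both numbers lie in one interval of length `r`, so the factor 2 of the triangle inequality is
-- avoided.
∣p-q∣≤r : ∀ {p q r} → 0ℚ ≤ p → p ≤ r → 0ℚ ≤ q → q ≤ r → ∣ p - q ∣ ≤ r
∣p-q∣≤r {p} {q} 0≤p p≤r 0≤q q≤r = ∣p∣≤q (p-q≤r p≤r 0≤q)
  (subst (_≤ _) (solve 2 (λ p q → q :- p := :- (p :- q)) refl p q) (p-q≤r q≤r 0≤p))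

nonneg*∣∣ : ∀ {p} q → 0ℚ ≤ p → ∣ p * q ∣ ≡ p * ∣ q ∣
nonneg*∣∣ {p} q 0≤p =
  trans (ℚ.∣p*q∣≡∣p∣*∣q∣ p q) (cong (_* ∣ q ∣) (ℚ.0≤p⇒∣p∣≡p 0≤p))

-- Finite sums

sum-mono-≤ : ∀ {n} {f g : Vector ℚ n} → (∀ i → f i ≤ g i) → sumℚ f ≤ sumℚ g
sum-mono-≤ {zero}  f≤g = ℚ.≤-refl
sum-mono-≤ {suc n} f≤g = ℚ.+-mono-≤ (f≤g zero) (sum-mono-≤ (f≤g ∘ suc))

sum-nonneg : ∀ {n} {f : Vector ℚ n} → (∀ i → 0ℚ ≤ f i) → 0ℚ ≤ sumℚ f
sum-nonneg {n} {f} 0≤f = subst (_≤ sumℚ f) (sum-replicate-zero n) (sum-mono-≤ 0≤f)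

sum-zero : ∀ {n} {f : Vector ℚ n} → (∀ i → f i ≡ 0ℚ) → sumℚ f ≡ 0ℚ
sum-zero {n} f≡0 = trans (sum-cong-≗ f≡0) (sum-replicate-zero n)

∣sum∣≤sum∣∣ : ∀ {n} (f : Vector ℚ n) → ∣ sumℚ f ∣ ≤ sumℚ (λ i → ∣ f i ∣)
∣sum∣≤sum∣∣ {zero}  f = ℚ.≤-refl
∣sum∣≤sum∣∣ {suc n} f = ℚ.≤-trans (ℚ.∣p+q∣≤∣p∣+∣q∣ (f zero) (sumℚ (tail f)))
  (ℚ.+-monoʳ-≤ ∣ f zero ∣ (∣sum∣≤sum∣∣ (tail f)))

sum-distrib-- : ∀ {n} (f g : Vector ℚ n) → sumℚ (λ i → f i - g i) ≡ sumℚ f - sumℚ g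
sum-distrib-- {zero}  f g = refl
sum-distrib-- {suc n} f g = trans
  (cong ((f zero - g zero) +_) (sum-distrib-- (tail f) (tail g)))
  (solve 4 (λ a b c d → (a :- b) :+ (c :- d) := (a :+ c) :- (b :+ d)) refl
    (f zero) (g zero) (sumℚ (tail f)) (sumℚ (tail g)))

sum-single : ∀ {n} (f : Vector ℚ n) v → (∀ u → u ≢ v → f u ≡ 0ℚ) → sumℚ f ≡ f v
sum-single f zero    f≡0 = trans
  (cong (f zero +_) (sum-zero (λ i → f≡0 (suc i) λ ()))) (ℚ.+-identityʳ (f zero))
sum-single f (suc v) f≡0 = trans
  (cong₂ _+_ (f≡0 zero λ ())
    (sum-single (tail f) v (λ u u≢v → f≡0 (suc u) (u≢v ∘ Fin.suc-injective))))
  (ℚ.+-identityˡ (f (suc v)))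

-- Sums over time are encoded as sums over `Fin n`, so that the laws of `sumℚ`, in particular the
-- exchange of two sums, apply to them.
range : (ℕ → ℚ) → ℕ → ℚ
range f n = sumℚ {n} (λ i → f (toℕ i))

range-cong : ∀ {f g} n → (∀ i → f i ≡ g i) → range f n ≡ range g n
range-cong n f≡g = sum-cong-≗ {n} (λ i → f≡g (toℕ i))

range-+ : ∀ f m n → range f (m ℕ.+ n) ≡ range f m + range (λ i → f (m ℕ.+ i)) n
range-+ f zero    n = sym (ℚ.+-identityˡ _)
range-+ f (suc m) n = trans (cong (f 0 +_) (range-+ (f ∘ suc) m n))
  (sym (ℚ.+-assoc (f 0) (range (f ∘ suc) m) _))

range-suc : ∀ f n → range f (suc n) ≡ range f n + f n
range-suc f n = trans (cong (range f) (ℕ.+-comm 1 n)) (trans (range-+ f n 1)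
  (cong (range f n +_) (trans (ℚ.+-identityʳ _) (cong f (ℕ.+-identityʳ n)))))

range-nonneg : ∀ {f} → (∀ i → 0ℚ ≤ f i) → ∀ n → 0ℚ ≤ range f n
range-nonneg 0≤f n = sum-nonneg {n} (λ i → 0≤f (toℕ i))

range-mono-≤ : ∀ {f m n} → (∀ i → 0ℚ ≤ f i) → m ℕ.≤ n → range f m ≤ range f n
range-mono-≤ {f} {m} {n} 0≤f m≤n = subst₂ _≤_ (ℚ.+-identityʳ _)
  (trans (sym (range-+ f m (n ℕ.∸ m))) (cong (range f) (ℕ.m+[n∸m]≡n m≤n)))
  (ℚ.+-monoʳ-≤ (range f m) (range-nonneg (λ i → 0≤f (m ℕ.+ i)) (n ℕ.∸ m)))

-- The tail is deliberately allowed `n` terms again, so that a termwise bound by `f` leads back to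
-- `range f n` itself.
range-split-≤ : ∀ {f} → (∀ i → 0ℚ ≤ f i) → ∀ k n →
                range f n ≤ range f k + range (λ i → f (k ℕ.+ i)) n
range-split-≤ {f} 0≤f k n = subst (range f n ≤_) (range-+ f k n)
  (range-mono-≤ 0≤f (ℕ.m≤n+m n k))

-- Moving the window by one step drops its first term and gains the term `m` places later, which is
-- equal by periodicity.
range-shift : ∀ {f m} → (∀ i → f (m ℕ.+ i) ≡ f i) → ∀ d →
              range (λ i → f (d ℕ.+ i)) m ≡ range f m
range-shift {f} {m} periodic zero    = refl
range-shift {f} {m} periodic (suc d) = trans (sym cancelled) (range-shift {f} {m} periodic d)
  where
  g : ℕ → ℚ
  g i = f (d ℕ.+ i)
  g-end : g m ≡ g 0
  g-end = trans (cong f (trans (ℕ.+-comm d m) (cong (m ℕ.+_) (sym (ℕ.+-identityʳ d)))))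
    (periodic (d ℕ.+ 0))
  -- Both sides add up the same `m + 1` terms, splitting off the last or the first.
  eq : range g m + g 0 ≡ range (λ i → f (suc d ℕ.+ i)) m + g 0
  eq = begin
    range g m + g 0              ≡⟨ cong (range g m +_) g-end ⟨
    range g m + g m              ≡⟨ range-suc g m ⟨
    g 0 + range (g ∘ suc) m      ≡⟨ ℚ.+-comm (g 0) _ ⟩
    range (g ∘ suc) m + g 0      ≡⟨ cong (_+ g 0) (range-cong m (λ i → cong f (ℕ.+-suc d i))) ⟩
    range (λ i → f (suc d ℕ.+ i)) m + g 0 ∎
    where open ≡-Reasoning
  cancelled : range g m ≡ range (λ i → f (suc d ℕ.+ i)) m
  cancelled = trans (sym (cancel (range g m) (g 0))) (trans (cong (_- g 0) eq) (cancel _ (g 0)))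
    where
    cancel : ∀ p q → p + q - q ≡ p
    cancel = solve 2 (λ p q → p :+ q :- q := p) refl

-- Extrema

≤maximum : ∀ {n} (f : Vector ℕ n) i → f i ℕ.≤ maximum f
≤maximum f zero    = ℕ.m≤m⊔n (f zero) (maximum (tail f))
≤maximum f (suc i) = ℕ.≤-trans (≤maximum (tail f) i) (ℕ.m≤n⊔m (f zero) (maximum (tail f)))

-- Through this, `πmin π` inherits positivity from the entries of `π`.
minimum-attained : ∀ {N} .{{_ : NonZero N}} (f : Vector ℚ N) → ∃[ i ] minimum f ≡ f i
minimum-attained {suc _} f = go (tail f) (λ i → suc i , refl)
  where
  -- The fold keeps the base value `head f` while the vector shrinks, so the induction runs over any
  -- `g` with entries taken from `f`.
  go : ∀ {n} (g : Vector ℚ n) → (∀ i → ∃[ j ] g i ≡ f j) →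
       ∃[ j ] foldr _⊓_ (head f) g ≡ f j
  go {zero}  g g∈f = zero , refl
  go {suc n} g g∈f with ℚ.⊓-sel (g zero) (foldr _⊓_ (head f) (tail g))
  ... | inj₁ eq = proj₁ (g∈f zero) , trans eq (proj₂ (g∈f zero))
  ... | inj₂ eq with j , eq′ ← go (tail g) (g∈f ∘ suc) = j , trans eq eq′

minimum≤ : ∀ {N} .{{_ : NonZero N}} (f : Vector ℚ N) → ∀ i → minimum f ≤ f i
minimum≤ {suc _} f = λ { zero → base (tail f) ; (suc i) → go (tail f) i }
  where
  base : ∀ {n} (g : Vector ℚ n) → foldr _⊓_ (head f) g ≤ head f
  base {zero}  g = ℚ.≤-refl
  base {suc n} g = ℚ.≤-trans (ℚ.p⊓q≤q (g zero) _) (base (tail g))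
  go : ∀ {n} (g : Vector ℚ n) i → foldr _⊓_ (head f) g ≤ g i
  go g zero    = ℚ.p⊓q≤p (g zero) _
  go g (suc i) = ℚ.≤-trans (ℚ.p⊓q≤q (g zero) _) (go (tail g) i)

-- Natural numbers as rationals

-- The division in `fromℕ` normalises by a gcd that is stuck on a variable `n`. With the constructor
-- exposed, addition unfolds to integer arithmetic.
fromℕ≡mkℚ : ∀ n → fromℕ n ≡ mkℚ (ℤ.+ n) 0 (Coprimality.sym (Coprimality.1-coprimeTo n))
fromℕ≡mkℚ n = ℚ.normalize-coprime (Coprimality.sym (Coprimality.1-coprimeTo n))

fromℕ-+ : ∀ m n → fromℕ (m ℕ.+ n) ≡ fromℕ m + fromℕ n
fromℕ-+ m n = sym (trans (cong₂ _+_ (fromℕ≡mkℚ m) (fromℕ≡mkℚ n))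
  (cong (ℚ._/ 1) (cong₂ ℤ._+_ (ℤ.*-identityʳ (ℤ.+ m)) (ℤ.*-identityʳ (ℤ.+ n)))))

fromℕ-sum : ∀ {n} (f : Vector ℕ n) → fromℕ (sumℕ f) ≡ sumℚ (λ i → fromℕ (f i))
fromℕ-sum {zero}  f = refl
fromℕ-sum {suc n} f = trans (fromℕ-+ (f zero) (sumℕ (tail f)))
  (cong (fromℕ (f zero) +_) (fromℕ-sum (tail f)))

0≤fromℕ : ∀ n → 0ℚ ≤ fromℕ n
0≤fromℕ n = ℚ.nonNegative⁻¹ (fromℕ n) {{ℚ.normalize-nonNeg n 1}}

fromℕ-mono-≤ : ∀ {m n} → m ℕ.≤ n → fromℕ m ≤ fromℕ n
fromℕ-mono-≤ {m} {n} m≤n = subst₂ _≤_ (ℚ.+-identityʳ _)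
  (trans (sym (fromℕ-+ m (n ℕ.∸ m))) (cong fromℕ (ℕ.m+[n∸m]≡n m≤n)))
  (ℚ.+-monoʳ-≤ (fromℕ m) (0≤fromℕ (n ℕ.∸ m)))

range-≤-const : ∀ {f c} → (∀ i → f i ≤ c) → ∀ n → range f n ≤ fromℕ n * c
range-≤-const {f} {c} f≤c zero    = ℚ.≤-reflexive (sym (ℚ.*-zeroˡ c))
range-≤-const {f} {c} f≤c (suc n) = subst (range f (suc n) ≤_)
  (trans (solve 2 (λ m c → c :+ m :* c := (con 1ℚ :+ m) :* c) refl (fromℕ n) c)
    (cong (_* c) (sym (fromℕ-+ 1 n))))
  (ℚ.+-mono-≤ (f≤c 0) (range-≤-const (f≤c ∘ suc) n))

range-1 : ∀ n → range (λ _ → 1ℚ) n ≡ fromℕ n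
range-1 zero    = refl
range-1 (suc n) = trans (cong (1ℚ +_) (range-1 n)) (sym (fromℕ-+ 1 n))

p≤q+½p⇒p≤q+q : ∀ p q → p ≤ q + ½ * p → p ≤ q + q
p≤q+½p⇒p≤q+q p q h = subst₂ _≤_
  (solve 1 (λ p → p :+ p :- p := p) refl p)
  (solve 2 (λ p q → (q :+ con ½ :* p) :+ (q :+ con ½ :* p) :- p := q :+ q) refl p q)
  (ℚ.+-monoˡ-≤ (- p) (ℚ.+-mono-≤ h h))

-- No geometric series is summed: the first `k` terms give at most `k * c`, and the rest at most
-- half of the sum, so the sum `S` satisfies `S ≤ k * c + ½ * S`.
range-halving : ∀ {f c} k → (∀ i → 0ℚ ≤ f i) → (∀ i → f i ≤ c) →
                (∀ i → f (k ℕ.+ i) ≤ ½ * f i) →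
                ∀ n → range f n ≤ fromℕ k * c + fromℕ k * c
range-halving {f} {c} k 0≤f f≤c halve n = p≤q+½p⇒p≤q+q (range f n) (fromℕ k * c) (ℚ.≤-trans
  (range-split-≤ 0≤f k n)
  (ℚ.+-mono-≤ (range-≤-const f≤c k) (ℚ.≤-trans
    (sum-mono-≤ {n} (λ i → halve (toℕ i)))
    (ℚ.≤-reflexive (sym (*-distribˡ-sum {n} ½ (λ i → f (toℕ i))))))))

-- Row vectors and matrices

identity-diag : ∀ {N} (v : Fin N) → identity v v ≡ 1ℚ
identity-diag v with v Fin.≟ v
... | yes _  = refl
... | no v≢v = contradiction refl v≢v

identity-off : ∀ {N} {u v : Fin N} → u ≢ v → identity u v ≡ 0ℚ
identity-off {u = u} {v} u≢v with u Fin.≟ v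
... | yes u≡v = contradiction u≡v u≢v
... | no  _   = refl

0≤identity : ∀ {N} (u v : Fin N) → 0ℚ ≤ identity u v
0≤identity u v with u Fin.≟ v
... | yes _ = ℚ.nonNegative⁻¹ 1ℚ
... | no  _ = ℚ.≤-refl

identity-isStochastic : ∀ {N} → IsStochastic (identity {N})
identity-isStochastic v = record
  { nonneg = 0≤identity v
  ; total  = trans (sum-single (identity v) v (λ u u≢v → identity-off (u≢v ∘ sym)))
      (identity-diag v)
  }

module _ {N : ℕ} where

  ⊡-congˡ : ∀ {ξ ζ : Vector ℚ N} (A : Matrix N) → (∀ u → ξ u ≡ ζ u) →
            ∀ v → (ξ ⊡ A) v ≡ (ζ ⊡ A) v
  ⊡-congˡ A ξ≡ζ v = sum-cong-≗ (λ u → cong (_* A u v) (ξ≡ζ u))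

  ⊡-congʳ : ∀ (ξ : Vector ℚ N) {A B : Matrix N} → (∀ u v → A u v ≡ B u v) →
            ∀ v → (ξ ⊡ A) v ≡ (ξ ⊡ B) v
  ⊡-congʳ ξ A≡B v = sum-cong-≗ (λ u → cong (ξ u *_) (A≡B u v))

  ⊡-identityʳ : ∀ (ξ : Vector ℚ N) v → (ξ ⊡ identity) v ≡ ξ v
  ⊡-identityʳ ξ v = trans
    (sum-single _ v (λ u u≢v → trans (cong (ξ u *_) (identity-off u≢v)) (ℚ.*-zeroʳ (ξ u))))
    (trans (cong (ξ v *_) (identity-diag v)) (ℚ.*-identityʳ (ξ v)))

  ⊡-assoc : ∀ (ξ : Vector ℚ N) (A B : Matrix N) v → ((ξ ⊡ A) ⊡ B) v ≡ (ξ ⊡ (A ⊠ B)) v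
  ⊡-assoc ξ A B v = begin
    sumℚ (λ x → sumℚ (λ u → ξ u * A u x) * B x v)
      ≡⟨ sum-cong-≗ (λ x → *-distribʳ-sum (B x v) (λ u → ξ u * A u x)) ⟩
    sumℚ (λ x → sumℚ (λ u → ξ u * A u x * B x v))
      ≡⟨ ∑-comm (λ x u → ξ u * A u x * B x v) ⟩
    sumℚ (λ u → sumℚ (λ x → ξ u * A u x * B x v))
      ≡⟨ sum-cong-≗ (λ u → trans (sum-cong-≗ (λ x → ℚ.*-assoc (ξ u) (A u x) (B x v)))
           (sym (*-distribˡ-sum (ξ u) (λ x → A u x * B x v)))) ⟩
    sumℚ (λ u → ξ u * sumℚ (λ x → A u x * B x v)) ∎
    where open ≡-Reasoning

  ⊡-distribˡ-- : ∀ (ξ ζ : Vector ℚ N) (A : Matrix N) v →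
                 ((λ u → ξ u - ζ u) ⊡ A) v ≡ (ξ ⊡ A) v - (ζ ⊡ A) v
  ⊡-distribˡ-- ξ ζ A v = trans
    (sum-cong-≗ (λ u → solve 3 (λ x z a → (x :- z) :* a := x :* a :- z :* a) refl
      (ξ u) (ζ u) (A u v)))
    (sum-distrib-- (λ u → ξ u * A u v) (λ u → ζ u * A u v))

  ⊡-isDistribution : ∀ {ξ : Vector ℚ N} {A : Matrix N} →
                     IsDistribution ξ → IsStochastic A → IsDistribution (ξ ⊡ A)
  ⊡-isDistribution {ξ} {A} dξ dA = record
    { nonneg = λ v → sum-nonneg (λ u →
        *-nonneg (IsDistribution.nonneg dξ u) (IsDistribution.nonneg (dA u) v))
    ; total  = begin
        sumℚ (λ v → sumℚ (λ u → ξ u * A u v))  ≡⟨ ∑-comm (λ v u → ξ u * A u v) ⟩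
        sumℚ (λ u → sumℚ (λ v → ξ u * A u v))
          ≡⟨ sum-cong-≗ (λ u → trans (sym (*-distribˡ-sum (ξ u) (A u)))
               (trans (cong (ξ u *_) (IsDistribution.total (dA u))) (ℚ.*-identityʳ (ξ u)))) ⟩
        sumℚ ξ                                 ≡⟨ IsDistribution.total dξ ⟩
        1ℚ                                     ∎
    }
    where open ≡-Reasoning

  ^-+ : ∀ (P : Matrix N) s t u v → (P ^ (s ℕ.+ t)) u v ≡ ((P ^ s) ⊠ (P ^ t)) u v
  ^-+ P s zero    u v = trans (cong (λ n → (P ^ n) u v) (ℕ.+-identityʳ s))
    (sym (⊡-identityʳ ((P ^ s) u) v))
  ^-+ P s (suc t) u v = trans (cong (λ n → (P ^ n) u v) (ℕ.+-suc s t))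
    (trans (⊡-congˡ P (^-+ P s t u) v) (⊡-assoc ((P ^ s) u) (P ^ t) P v))

  ^-1 : ∀ (P : Matrix N) u v → (P ^ 1) u v ≡ P u v
  ^-1 P u v = trans
    (sum-single _ u (λ x x≢u →
      trans (cong (_* P x v) (identity-off (x≢u ∘ sym))) (ℚ.*-zeroˡ (P x v))))
    (trans (cong (_* P u v) (identity-diag u)) (ℚ.*-identityˡ (P u v)))

  -- Powers are defined by adding a last step; splitting off the first step instead is what reversal
  -- and the unrolling of the error recursion require.
  ^-suc : ∀ (P : Matrix N) s u v → (P ^ suc s) u v ≡ (P ⊠ (P ^ s)) u v
  ^-suc P s u v = trans (^-+ P 1 s u v) (⊡-congˡ (P ^ s) (^-1 P u) v)

  ^-isStochastic : ∀ {P : Matrix N} → IsStochastic P → ∀ s → IsStochastic (P ^ s)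
  ^-isStochastic P-stoch zero    = identity-isStochastic
  ^-isStochastic P-stoch (suc s) = λ v →
    ⊡-isDistribution (^-isStochastic P-stoch s v) P-stoch

  ‖_‖ : Vector ℚ N → ℚ
  ‖ ξ ‖ = sumℚ (λ v → ∣ ξ v ∣)

  0≤‖_‖ : ∀ ξ → 0ℚ ≤ ‖ ξ ‖
  0≤‖ ξ ‖ = sum-nonneg (λ v → ℚ.0≤∣p∣ (ξ v))

  ‖‖-cong : ∀ {ξ ζ : Vector ℚ N} → (∀ v → ξ v ≡ ζ v) → ‖ ξ ‖ ≡ ‖ ζ ‖
  ‖‖-cong ξ≡ζ = sum-cong-≗ (λ v → cong ∣_∣ (ξ≡ζ v))

  distribution-norm : ∀ {ξ : Vector ℚ N} → IsDistribution ξ → ‖ ξ ‖ ≡ 1ℚ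
  distribution-norm dξ = trans
    (sum-cong-≗ (λ v → ℚ.0≤p⇒∣p∣≡p (IsDistribution.nonneg dξ v)))
    (IsDistribution.total dξ)

  ‖-‖≤ : ∀ (ξ ζ : Vector ℚ N) → ‖ (λ v → ξ v - ζ v) ‖ ≤ ‖ ξ ‖ + ‖ ζ ‖
  ‖-‖≤ ξ ζ = ℚ.≤-trans (sum-mono-≤ (λ v → ℚ.∣p-q∣≤∣p∣+∣q∣ (ξ v) (ζ v)))
    (ℚ.≤-reflexive (∑-distrib-+ (λ v → ∣ ξ v ∣) (λ v → ∣ ζ v ∣)))

  -- Exchanging the sums isolates the rows of `A`. A stochastic matrix allows `c = 1`, the deviation
  -- at the mixing rate `c = ½`.
  ‖⊡‖≤ : ∀ (ξ : Vector ℚ N) {A : Matrix N} {c} → (∀ u → ‖ A u ‖ ≤ c) → ‖ ξ ⊡ A ‖ ≤ ‖ ξ ‖ * c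
  ‖⊡‖≤ ξ {A} {c} A≤c = begin
    sumℚ (λ v → ∣ sumℚ (λ u → ξ u * A u v) ∣)
      ≤⟨ sum-mono-≤ (λ v → ∣sum∣≤sum∣∣ (λ u → ξ u * A u v)) ⟩
    sumℚ (λ v → sumℚ (λ u → ∣ ξ u * A u v ∣))
      ≡⟨ ∑-comm (λ v u → ∣ ξ u * A u v ∣) ⟩
    sumℚ (λ u → sumℚ (λ v → ∣ ξ u * A u v ∣))
      ≡⟨ sum-cong-≗ (λ u → trans (sum-cong-≗ (λ v → ℚ.∣p*q∣≡∣p∣*∣q∣ (ξ u) (A u v)))
           (sym (*-distribˡ-sum ∣ ξ u ∣ (λ v → ∣ A u v ∣)))) ⟩
    sumℚ (λ u → ∣ ξ u ∣ * ‖ A u ‖)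
      ≤⟨ sum-mono-≤ (λ u → *-monoˡ-≤ (ℚ.0≤∣p∣ (ξ u)) (A≤c u)) ⟩
    sumℚ (λ u → ∣ ξ u ∣ * c)
      ≡⟨ *-distribʳ-sum c (λ u → ∣ ξ u ∣) ⟨
    ‖ ξ ‖ * c ∎
    where open ℚ.≤-Reasoning

-- Deviation from stationarity

-- The norm of row `u` is twice the total variation distance between `(P ^ s) u` and `π`.
deviation : ∀ {N} → Matrix N → Vector ℚ N → ℕ → Matrix N
deviation P π s u v = (P ^ s) u v - π v

module _ {N : ℕ} (P : Matrix N) (π : Vector ℚ N) where

  -- A vector of total 0 is annihilated by the matrix whose rows all equal `π`.
  ⊡-deviation : ∀ (ξ : Vector ℚ N) → sumℚ ξ ≡ 0ℚ → ∀ s v →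
                (ξ ⊡ deviation P π s) v ≡ (ξ ⊡ (P ^ s)) v
  ⊡-deviation ξ Σξ≡0 s v = begin
    sumℚ (λ u → ξ u * ((P ^ s) u v - π v))
      ≡⟨ sum-cong-≗ (λ u → solve 3 (λ x a p → x :* (a :- p) := x :* a :- x :* p) refl
           (ξ u) ((P ^ s) u v) (π v)) ⟩
    sumℚ (λ u → ξ u * (P ^ s) u v - ξ u * π v)
      ≡⟨ sum-distrib-- (λ u → ξ u * (P ^ s) u v) (λ u → ξ u * π v) ⟩
    (ξ ⊡ (P ^ s)) v - sumℚ (λ u → ξ u * π v)
      ≡⟨ cong (λ x → (ξ ⊡ (P ^ s)) v - x) (trans (sym (*-distribʳ-sum (π v) ξ))
           (trans (cong (_* π v) Σξ≡0) (ℚ.*-zeroˡ (π v)))) ⟩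
    (ξ ⊡ (P ^ s)) v - 0ℚ
      ≡⟨ ℚ.+-identityʳ ((ξ ⊡ (P ^ s)) v) ⟩
    (ξ ⊡ (P ^ s)) v ∎
    where open ≡-Reasoning

module _ {N : ℕ} {P : Matrix N} {π : Vector ℚ N}
         (P-stochastic : IsStochastic P) (stationary : IsStationary P π) where
  open IsStationary stationary

  private
    dev : ℕ → Matrix N
    dev = deviation P π

  invariant-^ : ∀ s v → (π ⊡ (P ^ s)) v ≡ π v
  invariant-^ zero    v = ⊡-identityʳ π v
  invariant-^ (suc s) v = trans (sym (⊡-assoc π (P ^ s) P v))
    (trans (⊡-congˡ P (invariant-^ s) v) (invariant v))

  sum-deviation : ∀ s u → sumℚ (dev s u) ≡ 0ℚ
  sum-deviation s u = trans (sum-distrib-- ((P ^ s) u) π)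
    (cong₂ _-_ (IsDistribution.total (^-isStochastic P-stochastic s u))
      (IsDistribution.total distribution))

  deviation-⊡-^ : ∀ s t u v → (dev s u ⊡ (P ^ t)) v ≡ dev (s ℕ.+ t) u v
  deviation-⊡-^ s t u v = trans (⊡-distribˡ-- ((P ^ s) u) π (P ^ t) v)
    (cong₂ _-_ (sym (^-+ P s t u v)) (invariant-^ t v))

  -- Deviations multiply like powers: a row of `dev s` has total 0, so `dev t` acts on it as `P ^ t`
  -- does, and `P ^ t` fixes `π`.
  ‖deviation‖-+-≤ : ∀ s t u {c} → (∀ x → ‖ dev t x ‖ ≤ c) →
                    ‖ dev (s ℕ.+ t) u ‖ ≤ ‖ dev s u ‖ * c
  ‖deviation‖-+-≤ s t u {c} dev≤c = subst (_≤ ‖ dev s u ‖ * c)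
    (‖‖-cong (λ v → trans (⊡-deviation P π (dev s u) (sum-deviation s u) t v)
      (deviation-⊡-^ s t u v)))
    (‖⊡‖≤ (dev s u) dev≤c)

  -- Further stochastic steps do not increase the norm. This carries bounds to later times, such as
  -- from the mixing time of a single vertex to `t*`.
  ‖deviation‖-antitone : ∀ {s t} → s ℕ.≤ t → ∀ u → ‖ dev t u ‖ ≤ ‖ dev s u ‖
  ‖deviation‖-antitone {s} {t} s≤t u = subst₂ _≤_
    (‖‖-cong (λ v → trans (deviation-⊡-^ s (t ℕ.∸ s) u v)
      (cong (λ n → dev n u v) (ℕ.m+[n∸m]≡n s≤t))))
    (ℚ.*-identityʳ ‖ dev s u ‖)
    (‖⊡‖≤ (dev s u) (λ x → ℚ.≤-reflexive
      (distribution-norm (^-isStochastic P-stochastic (t ℕ.∸ s) x))))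

  ‖deviation‖≤2 : ∀ s u → ‖ dev s u ‖ ≤ 1ℚ + 1ℚ
  ‖deviation‖≤2 s u = subst (‖ dev s u ‖ ≤_)
    (cong₂ _+_ (distribution-norm (^-isStochastic P-stochastic s u))
      (distribution-norm distribution))
    (‖-‖≤ ((P ^ s) u) π)

  ‖deviation‖-at-mixing : ∀ {t*} → IsMixingRate P π t* → ∀ u → ‖ dev t* u ‖ ≤ ½
  ‖deviation‖-at-mixing {t*} (m , least , refl) u = ℚ.≤-trans
    (‖deviation‖-antitone (≤maximum m u) u)
    -- The threshold ¼ is `½ * ½`, and the factor ½ of `dTV` cancels.
    (ℚ.*-cancelˡ-≤-pos ½ (proj₁ (least u)))

  -- The norms are at most 2 before t*, and from t* on they are at most ½ and
  -- halve every t* steps, so the sum is at most 2 t* + (½ + ¼ + …) t*.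
  sum-‖deviation‖ : ∀ {t*} → IsMixingRate P π t* → ∀ u n →
                    range (λ s → ‖ dev s u ‖) n ≤ fromℕ 3 * fromℕ t*
  sum-‖deviation‖ {t*} mixing u n = ℚ.≤-trans
    (range-split-≤ {a} 0≤a t* n)
    (ℚ.≤-trans
      (ℚ.+-mono-≤ (range-≤-const {a} (λ s → ‖deviation‖≤2 s u) t*)
        (range-halving t* (λ s → 0≤a (t* ℕ.+ s)) late halve n))
      (ℚ.≤-reflexive (solve 1
        (λ t → t :* con (1ℚ + 1ℚ) :+ (t :* con ½ :+ t :* con ½) := con (fromℕ 3) :* t)
        refl (fromℕ t*))))
    where
    a : ℕ → ℚ
    a s = ‖ dev s u ‖
    0≤a : ∀ s → 0ℚ ≤ a s
    0≤a s = 0≤‖ dev s u ‖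
    half : ∀ x → ‖ dev t* x ‖ ≤ ½
    half = ‖deviation‖-at-mixing mixing
    late : ∀ s → a (t* ℕ.+ s) ≤ ½
    late s = ℚ.≤-trans (‖deviation‖-antitone (ℕ.m≤m+n t* s) u) (half u)
    halve : ∀ s → a (t* ℕ.+ (t* ℕ.+ s)) ≤ ½ * a (t* ℕ.+ s)
    -- The additional `t*` steps are placed last, where `half` bounds every row.
    halve s = subst₂ _≤_ (cong a (ℕ.+-comm (t* ℕ.+ s) t*)) (ℚ.*-comm (a (t* ℕ.+ s)) ½)
      (‖deviation‖-+-≤ (t* ℕ.+ s) t* u half)

  -- Reversibility and the propagation of errors

  module _ (reversible : IsReversible P π) where

    -- Detailed balance is applied to the factors in turn; they come out in reversed order, as
    -- `P ⊠ (P ^ s)`, which `^-suc` identifies with the next power.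
    reversible-^ : ∀ s → IsReversible (P ^ s) π
    reversible-^ zero u v with u Fin.≟ v
    ... | yes refl = cong (π u *_) (sym (identity-diag u))
    ... | no  u≢v  = trans (ℚ.*-zeroʳ (π u))
      (sym (trans (cong (π v *_) (identity-off (u≢v ∘ sym))) (ℚ.*-zeroʳ (π v))))
    reversible-^ (suc s) u v = begin
      π u * sumℚ (λ x → (P ^ s) u x * P x v)
        ≡⟨ *-distribˡ-sum (π u) (λ x → (P ^ s) u x * P x v) ⟩
      sumℚ (λ x → π u * ((P ^ s) u x * P x v))
        ≡⟨ sum-cong-≗ swap ⟩
      sumℚ (λ x → π v * (P v x * (P ^ s) x u))
        ≡⟨ *-distribˡ-sum (π v) (λ x → P v x * (P ^ s) x u) ⟨
      π v * (P ⊠ (P ^ s)) v u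
        ≡⟨ cong (π v *_) (^-suc P s v u) ⟨
      π v * (P ^ suc s) v u ∎
      where
      open ≡-Reasoning
      swap : ∀ x → π u * ((P ^ s) u x * P x v) ≡ π v * (P v x * (P ^ s) x u)
      swap x = begin
        π u * ((P ^ s) u x * P x v)  ≡⟨ ℚ.*-assoc (π u) _ _ ⟨
        π u * (P ^ s) u x * P x v    ≡⟨ cong (_* P x v) (reversible-^ s u x) ⟩
        π x * (P ^ s) x u * P x v
          ≡⟨ solve 3 (λ a b c → a :* b :* c := a :* c :* b) refl (π x) ((P ^ s) x u) (P x v) ⟩
        π x * P x v * (P ^ s) x u    ≡⟨ cong (_* (P ^ s) x u) (reversible x v) ⟩
        π v * P v x * (P ^ s) x u    ≡⟨ ℚ.*-assoc (π v) _ _ ⟩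
        π v * (P v x * (P ^ s) x u)  ∎

    -- The subtracted product `π u * π w` is symmetric, so detailed balance survives the
    -- subtraction.
    deviation-reversible : ∀ s u w → π u * dev s u w ≡ π w * dev s w u
    deviation-reversible s u w = begin
      π u * ((P ^ s) u w - π w)
        ≡⟨ solve 3 (λ a b c → a :* (b :- c) := a :* b :- a :* c) refl (π u) ((P ^ s) u w) (π w) ⟩
      π u * (P ^ s) u w - π u * π w
        ≡⟨ cong₂ _-_ (reversible-^ s u w) (ℚ.*-comm (π u) (π w)) ⟩
      π w * (P ^ s) w u - π w * π u
        ≡⟨ solve 3 (λ a b c → a :* b :- a :* c := a :* (b :- c)) refl (π w) ((P ^ s) w u) (π u) ⟩
      π w * ((P ^ s) w u - π u) ∎
      where open ≡-Reasoning

    -- Reversibility turns the weight π v P v u into π u P u v, whose sum over v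
    -- is π u; this is why the number of edges into u does not enter.
    inflow-deviation-≤ : ∀ {p} → (∀ v → p ≤ π v) → ∀ s u w →
      p * (sumℚ (λ v → P v u) * ∣ dev s u w ∣) ≤ π w * ∣ dev s w u ∣
    inflow-deviation-≤ {p} p≤π s u w = begin
      p * (sumℚ (λ v → P v u) * d)
        ≡⟨ cong (p *_) (*-distribʳ-sum d (λ v → P v u)) ⟩
      p * sumℚ (λ v → P v u * d)
        ≡⟨ *-distribˡ-sum p (λ v → P v u * d) ⟩
      sumℚ (λ v → p * (P v u * d))
        -- Raising `p` to `π v` separately in each summand creates the product to which detailed
        -- balance applies.
        ≤⟨ sum-mono-≤ (λ v → *-monoʳ-≤ (*-nonneg (P≥0 v u) (ℚ.0≤∣p∣ (dev s u w))) (p≤π v)) ⟩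
      sumℚ (λ v → π v * (P v u * d))
        ≡⟨ sum-cong-≗ transfer ⟩
      sumℚ (λ v → P u v * (π u * d))
        ≡⟨ *-distribʳ-sum (π u * d) (P u) ⟨
      sumℚ (P u) * (π u * d)
        ≡⟨ trans (cong (_* (π u * d)) (IsDistribution.total (P-stochastic u)))
             (ℚ.*-identityˡ (π u * d)) ⟩
      π u * d
        ≡⟨ nonneg*∣∣ (dev s u w) (π≥0 u) ⟨
      ∣ π u * dev s u w ∣
        ≡⟨ cong ∣_∣ (deviation-reversible s u w) ⟩
      ∣ π w * dev s w u ∣
        ≡⟨ nonneg*∣∣ (dev s w u) (π≥0 w) ⟩
      π w * ∣ dev s w u ∣ ∎
      where
      open ℚ.≤-Reasoning
      d : ℚ
      d = ∣ dev s u w ∣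
      P≥0 : ∀ x y → 0ℚ ≤ P x y
      P≥0 x = IsDistribution.nonneg (P-stochastic x)
      π≥0 : ∀ x → 0ℚ ≤ π x
      π≥0 = IsDistribution.nonneg distribution
      transfer : ∀ v → π v * (P v u * d) ≡ P u v * (π u * d)
      transfer v = trans (sym (ℚ.*-assoc (π v) (P v u) d))
        (trans (cong (_* d) (reversible v u))
          (solve 3 (λ a b c → a :* b :* c := b :* (a :* c)) refl (π u) (P u v) d))

    -- The value at `w` involves column `w` of the deviation, whereas mixing controls rows.
    -- `inflow-deviation-≤` turns the column into row `w` and absorbs the inflow weights, at the
    -- price of the factor `p`.
    ∣⊡-^∣≤ : ∀ {p D} → 0ℚ ≤ p → (∀ v → p ≤ π v) → 0ℚ ≤ D →
      ∀ (ξ : Vector ℚ N) → sumℚ ξ ≡ 0ℚ → (∀ u → ∣ ξ u ∣ ≤ D * sumℚ (λ v → P v u)) →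
      ∀ s w → p * ∣ (ξ ⊡ (P ^ s)) w ∣ ≤ D * (π w * ‖ dev s w ‖)
    ∣⊡-^∣≤ {p} {D} 0≤p p≤π 0≤D ξ Σξ≡0 ξ≤ s w = begin
      p * ∣ (ξ ⊡ (P ^ s)) w ∣
        ≡⟨ cong (λ x → p * ∣ x ∣) (⊡-deviation P π ξ Σξ≡0 s w) ⟨
      p * ∣ (ξ ⊡ dev s) w ∣
        ≤⟨ *-monoˡ-≤ 0≤p (∣sum∣≤sum∣∣ (λ u → ξ u * dev s u w)) ⟩
      p * sumℚ (λ u → ∣ ξ u * dev s u w ∣)
        ≤⟨ *-monoˡ-≤ 0≤p (sum-mono-≤ termwise) ⟩
      p * sumℚ (λ u → D * sumℚ (λ v → P v u) * ∣ dev s u w ∣)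
        ≡⟨ *-distribˡ-sum p (λ u → D * sumℚ (λ v → P v u) * ∣ dev s u w ∣) ⟩
      sumℚ (λ u → p * (D * sumℚ (λ v → P v u) * ∣ dev s u w ∣))
        ≡⟨ sum-cong-≗ (λ u → solve 4 (λ p d x y → p :* (d :* x :* y) := d :* (p :* (x :* y))) refl
             p D (sumℚ (λ v → P v u)) ∣ dev s u w ∣) ⟩
      sumℚ (λ u → D * (p * (sumℚ (λ v → P v u) * ∣ dev s u w ∣)))
        ≤⟨ sum-mono-≤ (λ u → *-monoˡ-≤ 0≤D (inflow-deviation-≤ p≤π s u w)) ⟩
      sumℚ (λ u → D * (π w * ∣ dev s w u ∣))
        ≡⟨ *-distribˡ-sum D (λ u → π w * ∣ dev s w u ∣) ⟨
      D * sumℚ (λ u → π w * ∣ dev s w u ∣)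
        ≡⟨ cong (D *_) (*-distribˡ-sum (π w) (λ u → ∣ dev s w u ∣)) ⟨
      D * (π w * ‖ dev s w ‖) ∎
      where
      open ℚ.≤-Reasoning
      termwise : ∀ u → ∣ ξ u * dev s u w ∣ ≤ D * sumℚ (λ v → P v u) * ∣ dev s u w ∣
      termwise u = subst (_≤ D * sumℚ (λ v → P v u) * ∣ dev s u w ∣)
        (sym (ℚ.∣p*q∣≡∣p∣*∣q∣ (ξ u) (dev s u w)))
        (*-monoʳ-≤ (ℚ.0≤∣p∣ (dev s u w)) (ξ≤ u))

    -- Unrolling χ (t + 1) = χ t P + ρ t leaves the errors ρ t pushed forward
    -- by the remaining powers of P.
    ∣discrepancy∣≤ : ∀ {p D} → 0ℚ ≤ p → (∀ v → p ≤ π v) → 0ℚ ≤ D →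
      ∀ (e ρ : ℕ → Vector ℚ N) → (∀ v → e 0 v ≡ 0ℚ) →
      (∀ t v → e (suc t) v ≡ (e t ⊡ P) v + ρ t v) →
      (∀ t → sumℚ (ρ t) ≡ 0ℚ) → (∀ t u → ∣ ρ t u ∣ ≤ D * sumℚ (λ v → P v u)) →
      ∀ w T s → p * ∣ (e T ⊡ (P ^ s)) w ∣ ≤ D * (π w * range (λ i → ‖ dev (i ℕ.+ s) w ‖) T)
    ∣discrepancy∣≤ {p} {D} 0≤p p≤π 0≤D e ρ e₀≡0 e-suc Σρ≡0 ρ≤ w zero s = begin
      p * ∣ (e 0 ⊡ (P ^ s)) w ∣
        ≡⟨ cong (λ x → p * ∣ x ∣) (sum-zero (λ u →
             trans (cong (_* (P ^ s) u w) (e₀≡0 u)) (ℚ.*-zeroˡ ((P ^ s) u w)))) ⟩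
      p * 0ℚ
        ≡⟨ solve 3 (λ p d x → p :* con 0ℚ := d :* (x :* con 0ℚ)) refl p D (π w) ⟩
      D * (π w * 0ℚ) ∎
      where open ℚ.≤-Reasoning
    ∣discrepancy∣≤ {p} {D} 0≤p p≤π 0≤D e ρ e₀≡0 e-suc Σρ≡0 ρ≤ w (suc T) s = begin
      p * ∣ (e (suc T) ⊡ (P ^ s)) w ∣
        ≡⟨ cong (λ x → p * ∣ x ∣) step ⟩
      p * ∣ (e T ⊡ (P ^ suc s)) w + (ρ T ⊡ (P ^ s)) w ∣
        ≤⟨ *-monoˡ-≤ 0≤p (ℚ.∣p+q∣≤∣p∣+∣q∣ ((e T ⊡ (P ^ suc s)) w) ((ρ T ⊡ (P ^ s)) w)) ⟩
      p * (∣ (e T ⊡ (P ^ suc s)) w ∣ + ∣ (ρ T ⊡ (P ^ s)) w ∣)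
        ≡⟨ ℚ.*-distribˡ-+ p _ _ ⟩
      p * ∣ (e T ⊡ (P ^ suc s)) w ∣ + p * ∣ (ρ T ⊡ (P ^ s)) w ∣
        ≤⟨ ℚ.+-mono-≤
             -- The exponent `s` is kept general because the older errors travel one step further,
             -- while `ρ T` contributes the term `i = 0`.
             (∣discrepancy∣≤ 0≤p p≤π 0≤D e ρ e₀≡0 e-suc Σρ≡0 ρ≤ w T (suc s))
             (∣⊡-^∣≤ 0≤p p≤π 0≤D (ρ T) (Σρ≡0 T) (ρ≤ T) s w) ⟩
      D * (π w * range (λ i → ‖ dev (i ℕ.+ suc s) w ‖) T) + D * (π w * ‖ dev s w ‖)
        ≡⟨ solve 4 (λ d x y z → d :* (x :* y) :+ d :* (x :* z) := d :* (x :* (z :+ y))) refl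
             D (π w) (range (λ i → ‖ dev (i ℕ.+ suc s) w ‖) T) ‖ dev s w ‖ ⟩
      D * (π w * (‖ dev s w ‖ + range (λ i → ‖ dev (i ℕ.+ suc s) w ‖) T))
        ≡⟨ cong (λ x → D * (π w * (‖ dev s w ‖ + x)))
             (range-cong T (λ i → cong (λ n → ‖ dev n w ‖) (ℕ.+-suc i s))) ⟩
      D * (π w * range (λ i → ‖ dev (i ℕ.+ s) w ‖) (suc T)) ∎
      where
      open ℚ.≤-Reasoning
      step : (e (suc T) ⊡ (P ^ s)) w ≡ (e T ⊡ (P ^ suc s)) w + (ρ T ⊡ (P ^ s)) w
      step = begin-equality
        (e (suc T) ⊡ (P ^ s)) w
          ≡⟨ sum-cong-≗ (λ u → trans (cong (_* (P ^ s) u w) (e-suc T u))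
               (ℚ.*-distribʳ-+ ((P ^ s) u w) ((e T ⊡ P) u) (ρ T u))) ⟩
        sumℚ (λ u → (e T ⊡ P) u * (P ^ s) u w + ρ T u * (P ^ s) u w)
          ≡⟨ ∑-distrib-+ (λ u → (e T ⊡ P) u * (P ^ s) u w) (λ u → ρ T u * (P ^ s) u w) ⟩
        ((e T ⊡ P) ⊡ (P ^ s)) w + (ρ T ⊡ (P ^ s)) w
          ≡⟨ cong (_+ (ρ T ⊡ (P ^ s)) w) (trans (⊡-assoc (e T) P (P ^ s) w)
               (⊡-congʳ (e T) (λ u v → sym (^-suc P s u v)) w)) ⟩
        (e T ⊡ (P ^ suc s)) w + (ρ T ⊡ (P ^ s)) w ∎

-- Rotor-router walks

-- Whole periods contribute nothing to the difference, so only `n % δ` terms remain. Their sum and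
-- its ideal value both lie between 0 and `fromℕ δ * p`.
∣range-periodic∣≤ : ∀ {f p} δ .{{_ : NonZero δ}} → (∀ i → 0ℚ ≤ f i) →
  (∀ i → f (δ ℕ.+ i) ≡ f i) → 0ℚ ≤ p → range f δ ≡ fromℕ δ * p →
  ∀ n → ∣ range f n - fromℕ n * p ∣ ≤ fromℕ δ * p
∣range-periodic∣≤ {f} {p} δ 0≤f periodic 0≤p total n =
  subst (λ m → ∣ D m ∣ ≤ fromℕ δ * p)
    (trans (ℕ.+-comm (n ℕ./ δ ℕ.* δ) (n ℕ.% δ)) (sym (ℕ.m≡m%n+[m/n]*n n δ)))
    (subst (λ d → ∣ d ∣ ≤ fromℕ δ * p) (sym (D-periods (n ℕ./ δ) (n ℕ.% δ)))
      (∣p-q∣≤r (range-nonneg 0≤f r)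
        (subst (range f r ≤_) total (range-mono-≤ 0≤f r≤δ))
        (*-nonneg (0≤fromℕ r) 0≤p)
        (*-monoʳ-≤ 0≤p (fromℕ-mono-≤ r≤δ))))
  where
  r : ℕ
  r = n ℕ.% δ
  r≤δ : r ℕ.≤ δ
  r≤δ = ℕ.m%n≤n n δ
  D : ℕ → ℚ
  D m = range f m - fromℕ m * p
  D-period : ∀ m → D (δ ℕ.+ m) ≡ D m
  D-period m = begin
    range f (δ ℕ.+ m) - fromℕ (δ ℕ.+ m) * p
      ≡⟨ cong₂ (λ x y → x - y * p)
           (trans (range-+ f δ m) (cong₂ _+_ total (range-cong m periodic))) (fromℕ-+ δ m) ⟩
    fromℕ δ * p + range f m - (fromℕ δ + fromℕ m) * p
      ≡⟨ solve 4 (λ d p x m → d :* p :+ x :- (d :+ m) :* p := x :- m :* p) refl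
           (fromℕ δ) p (range f m) (fromℕ m) ⟩
    D m ∎
    where open ≡-Reasoning
  D-periods : ∀ q m → D (q ℕ.* δ ℕ.+ m) ≡ D m
  D-periods zero    m = refl
  D-periods (suc q) m = trans (cong D (ℕ.+-assoc δ (q ℕ.* δ) m))
    (trans (D-period (q ℕ.* δ ℕ.+ m)) (D-periods q m))

-- General in `g` because `applyUpTo` recurses with `g ∘ suc`. Entries of `identity` serve as
-- indicators, so that row sums count each move once.
occurrences-applyUpTo : ∀ {N} (σ : ℕ → Fin N) u g n →
  fromℕ (length (filter (λ j → σ j Fin.≟ u) (applyUpTo g n))) ≡
  range (λ i → identity (σ (g i)) u) n
occurrences-applyUpTo σ u g zero = refl
-- `filter` and `identity` decide by the same test, so one case split evaluates both sides.
occurrences-applyUpTo σ u g (suc n) with σ (g 0) Fin.≟ u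
... | yes _ = trans
  (fromℕ-+ 1 (length (filter (λ j → σ j Fin.≟ u) (applyUpTo (g ∘ suc) n))))
  (cong (1ℚ +_) (occurrences-applyUpTo σ u (g ∘ suc) n))
... | no  _ = trans (occurrences-applyUpTo σ u (g ∘ suc) n) (sym (ℚ.+-identityˡ _))

fromℕ-occurrences : ∀ {N} (σ : ℕ → Fin N) u z n →
  fromℕ (occurrences σ u z (z ℕ.+ n)) ≡ range (λ i → identity (σ (z ℕ.+ i)) u) n
fromℕ-occurrences σ u z n = trans (occurrences-applyUpTo σ u (z ℕ.+_) ((z ℕ.+ n) ℕ.∸ z))
  (cong (range (λ i → identity (σ (z ℕ.+ i)) u)) (ℕ.m+n∸m≡n z n))

-- Regularity of a single rotor

module _ {N : ℕ} {P : Matrix N} (P-stochastic : IsStochastic P)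
         {G : Multidigraph P} (R : RotorRouter P G) where
  open Multidigraph G
  open RotorRouter R

  private
    P≥0 : ∀ v u → 0ℚ ≤ P v u
    P≥0 v = IsDistribution.nonneg (P-stochastic v)

  σ-periodic : ∀ v i → σ v (δ v ℕ.+ i) ≡ σ v i
  σ-periodic v i = trans (periodic v (δ v ℕ.+ i))
    (trans (cong (σ v) (trans (cong (ℕ._% δ v) (ℕ.+-comm (δ v) i)) (ℕ.[m+n]%n≡m%n i (δ v))))
      (sym (periodic v i)))

  -- For neighbours this is `balanced`. For any other `u` both sides are 0, since by `neighbour` the
  -- rotor never points there during a period.
  period-count : ∀ v u → range (λ i → identity (σ v i) u) (δ v) ≡ fromℕ (δ v) * P v u
  period-count v u with 0ℚ ℚ.<? P v u
  ... | yes 0<Pvu  = trans (sym (fromℕ-occurrences (σ v) u 0 (δ v))) (balanced v u 0<Pvu)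
  ... | no  ¬0<Pvu = trans
    (sum-zero {δ v} (λ i → identity-off (λ σ≡u →
      ¬0<Pvu (subst (λ x → 0ℚ < P v x) σ≡u (neighbour v (toℕ i) (Fin.toℕ<n i))))))
    (sym (trans (cong (fromℕ (δ v) *_) (ℚ.≤-antisym (ℚ.≮⇒≥ ¬0<Pvu) (P≥0 v u)))
      (ℚ.*-zeroʳ (fromℕ (δ v)))))

  -- By periodicity every window of `δ v` moves has the same counts, so the bound holds from any
  -- rotor position `z`.
  ∣occurrences-∣≤ : ∀ v u z n →
    ∣ fromℕ (occurrences (σ v) u z (z ℕ.+ n)) - fromℕ n * P v u ∣ ≤ fromℕ (δ v) * P v u
  ∣occurrences-∣≤ v u z n = subst (λ x → ∣ x - fromℕ n * P v u ∣ ≤ fromℕ (δ v) * P v u)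
    (sym (fromℕ-occurrences (σ v) u z n))
    (∣range-periodic∣≤ (δ v) (λ i → 0≤identity (σ v (z ℕ.+ i)) u) window (P≥0 v u)
      (trans (range-shift {f} {δ v} f-periodic z) (period-count v u)) n)
    where
    f : ℕ → ℚ
    f i = identity (σ v i) u
    f-periodic : ∀ i → f (δ v ℕ.+ i) ≡ f i
    f-periodic i = cong (λ x → identity x u) (σ-periodic v i)
    window : ∀ i → f (z ℕ.+ (δ v ℕ.+ i)) ≡ f (z ℕ.+ i)
    window i = trans
      (cong f (trans (sym (ℕ.+-assoc z (δ v) i))
        (trans (cong (ℕ._+ i) (ℕ.+-comm z (δ v))) (ℕ.+-assoc (δ v) z i))))
      (f-periodic (z ℕ.+ i))

  -- Every move of the rotor serves exactly one vertex, so tokens are conserved.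
  sum-occurrences : ∀ v z n → sumℚ (λ u → fromℕ (occurrences (σ v) u z (z ℕ.+ n))) ≡ fromℕ n
  sum-occurrences v z n = begin
    sumℚ (λ u → fromℕ (occurrences (σ v) u z (z ℕ.+ n)))
      ≡⟨ sum-cong-≗ (λ u → fromℕ-occurrences (σ v) u z n) ⟩
    sumℚ (λ u → range (λ i → identity (σ v (z ℕ.+ i)) u) n)
      ≡⟨ ∑-comm {N} {n} (λ u i → identity (σ v (z ℕ.+ toℕ i)) u) ⟩
    range (λ i → sumℚ (identity (σ v (z ℕ.+ i)))) n
      ≡⟨ range-cong n (λ i → IsDistribution.total (identity-isStochastic (σ v (z ℕ.+ i)))) ⟩
    range (λ _ → 1ℚ) n
      ≡⟨ range-1 n ⟩
    fromℕ n ∎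
    where open ≡-Reasoning

  -- One-step errors and discrepancy of a run

  module _ (χ₀ : Vector ℕ N) where
    open Run χ₀

    -- This is `ρ t`, written as a sum over the vertices that tokens leave, so that each rotor can
    -- be estimated alone.
    stepError : ℕ → Vector ℚ N
    stepError t u = sumℚ (λ v → fromℕ (Z t v u) - fromℕ (χ t v) * P v u)

    χ-suc : ∀ t u → fromℕ (χ (suc t) u) ≡ ((λ v → fromℕ (χ t v)) ⊡ P) u + stepError t u
    χ-suc t u = trans (fromℕ-sum (λ v → Z t v u))
      (trans (solve 2 (λ z x → z := x :+ (z :- x)) refl
          (sumℚ (λ v → fromℕ (Z t v u))) (sumℚ (λ v → fromℕ (χ t v) * P v u)))
        (cong (((λ v → fromℕ (χ t v)) ⊡ P) u +_)
          (sym (sum-distrib-- (λ v → fromℕ (Z t v u)) (λ v → fromℕ (χ t v) * P v u)))))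

    -- Rotor and chain both pass on all `χ t v` tokens of each vertex, so the errors cancel over the
    -- targets.
    sum-stepError : ∀ t → sumℚ (stepError t) ≡ 0ℚ
    sum-stepError t = trans (∑-comm (λ u v → fromℕ (Z t v u) - fromℕ (χ t v) * P v u))
      (sum-zero (λ v → trans
        (sum-distrib-- (λ u → fromℕ (Z t v u)) (λ u → fromℕ (χ t v) * P v u))
        (trans (cong₂ _-_ (sum-occurrences v (departed t v) (χ t v))
            (trans (sym (*-distribˡ-sum (fromℕ (χ t v)) (P v)))
              (trans (cong (fromℕ (χ t v) *_) (IsDistribution.total (P-stochastic v)))
                (ℚ.*-identityʳ (fromℕ (χ t v))))))
          (ℚ.+-inverseʳ (fromℕ (χ t v))))))

    ∣stepError∣≤ : ∀ t u → ∣ stepError t u ∣ ≤ fromℕ Δ * sumℚ (λ v → P v u)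
    ∣stepError∣≤ t u = begin
      ∣ stepError t u ∣
        ≤⟨ ∣sum∣≤sum∣∣ (λ v → fromℕ (Z t v u) - fromℕ (χ t v) * P v u) ⟩
      sumℚ (λ v → ∣ fromℕ (Z t v u) - fromℕ (χ t v) * P v u ∣)
        ≤⟨ sum-mono-≤ (λ v → ℚ.≤-trans
             (∣occurrences-∣≤ v u (departed t v) (χ t v))
             (*-monoʳ-≤ (P≥0 v u) (fromℕ-mono-≤ (≤maximum δ v)))) ⟩
      sumℚ (λ v → fromℕ Δ * P v u)
        ≡⟨ *-distribˡ-sum (fromℕ Δ) (λ v → P v u) ⟨
      fromℕ Δ * sumℚ (λ v → P v u) ∎
      where open ℚ.≤-Reasoning

    discrepancy : ℕ → Vector ℚ N
    discrepancy t v = fromℕ (χ t v) - μ P χ₀ t v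

    discrepancy-zero : ∀ v → discrepancy 0 v ≡ 0ℚ
    discrepancy-zero v = trans
      (cong (λ x → fromℕ (χ₀ v) - x) (⊡-identityʳ (λ u → fromℕ (χ₀ u)) v))
      (ℚ.+-inverseʳ (fromℕ (χ₀ v)))

    discrepancy-suc : ∀ t v → discrepancy (suc t) v ≡ (discrepancy t ⊡ P) v + stepError t v
    discrepancy-suc t v = begin
      fromℕ (χ (suc t) v) - μ P χ₀ (suc t) v
        ≡⟨ cong₂ _-_ (χ-suc t v) (sym (⊡-assoc (λ u → fromℕ (χ₀ u)) (P ^ t) P v)) ⟩
      χP + stepError t v - μP
        ≡⟨ solve 3 (λ x e y → x :+ e :- y := x :- y :+ e) refl χP (stepError t v) μP ⟩
      χP - μP + stepError t v
        ≡⟨ cong (_+ stepError t v) (⊡-distribˡ-- (λ u → fromℕ (χ t u)) (μ P χ₀ t) P v) ⟨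
      (discrepancy t ⊡ P) v + stepError t v ∎
      where
      open ≡-Reasoning
      χP μP : ℚ
      χP = ((λ u → fromℕ (χ t u)) ⊡ P) v
      μP = (μ P χ₀ t ⊡ P) v

theorem5p10 : ∀ {N : ℕ} .{{_ : NonZero N}} (P : Matrix N) (π : Vector ℚ N)
    (ergodic : IsErgodic P) (stationary : IsStationary P π) → IsReversible P π →
    (t* : ℕ) → IsMixingRate P π t* →
    (G : Multidigraph P) (R : RotorRouter P G) (χ₀ : Vector ℕ N) →
    ∀ (w : Fin N) (T : ℕ) →
    ∣ fromℕ (RotorRouter.Run.χ R χ₀ T w) - μ P χ₀ T w ∣
      ≤ (_÷_ (fromℕ 3 * π w) (πmin π) {{πmin-nonZero ergodic stationary}})
          * fromℕ t* * fromℕ (Multidigraph.Δ G)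
theorem5p10 {N} P π ergodic stationary reversible t* mixing G R χ₀ w T =
  -- Both sides are multiplied by the positive `πmin π`, which clears the quotient.
  ℚ.*-cancelˡ-≤-pos p {{ℚ.positive 0<p}} (begin
    p * ∣ e T w ∣
      ≡⟨ cong (λ x → p * ∣ x ∣) (⊡-identityʳ (e T) w) ⟨
    p * ∣ (e T ⊡ identity) w ∣
      ≤⟨ ∣discrepancy∣≤ stochastic stationary reversible (ℚ.<⇒≤ 0<p) (minimum≤ π) (0≤fromℕ Δ)
           e (stepError stochastic R χ₀)
           (discrepancy-zero stochastic R χ₀) (discrepancy-suc stochastic R χ₀)
           (sum-stepError stochastic R χ₀) (∣stepError∣≤ stochastic R χ₀) w T 0 ⟩
    fromℕ Δ * (π w * range (λ i → ‖ deviation P π (i ℕ.+ 0) w ‖) T)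
      ≡⟨ cong (λ x → fromℕ Δ * (π w * x))
           (range-cong T (λ i → cong (λ n → ‖ deviation P π n w ‖) (ℕ.+-identityʳ i))) ⟩
    fromℕ Δ * (π w * range (λ i → ‖ deviation P π i w ‖) T)
      ≤⟨ *-monoˡ-≤ (0≤fromℕ Δ) (*-monoˡ-≤ (ℚ.<⇒≤ (π-pos ergodic stationary w))
           (sum-‖deviation‖ stochastic stationary mixing w T)) ⟩
    fromℕ Δ * (π w * (fromℕ 3 * fromℕ t*))
      -- The factor `1ℚ` is inserted to be rewritten as `p * 1/ p`, which restores the quotient of
      -- the claim.
      ≡⟨ solve 4 (λ d x c t → d :* (x :* (c :* t)) := con 1ℚ :* (c :* x :* t :* d)) refl
           (fromℕ Δ) (π w) (fromℕ 3) (fromℕ t*) ⟩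
    1ℚ * (fromℕ 3 * π w * fromℕ t* * fromℕ Δ)
      ≡⟨ cong (_* (fromℕ 3 * π w * fromℕ t* * fromℕ Δ)) (ℚ.*-inverseʳ p) ⟨
    p * 1/ p * (fromℕ 3 * π w * fromℕ t* * fromℕ Δ)
      ≡⟨ solve 6 (λ p q c x t d → p :* q :* (c :* x :* t :* d) := p :* (c :* x :* q :* t :* d)) refl
           p (1/ p) (fromℕ 3) (π w) (fromℕ t*) (fromℕ Δ) ⟩
    p * (fromℕ 3 * π w ÷ p * fromℕ t* * fromℕ Δ) ∎)
  where
  open IsErgodic ergodic using (stochastic)
  open Multidigraph G using (Δ)
  open ℚ.≤-Reasoning
  instance
    p≢0 : ℚ.NonZero (πmin π)
    p≢0 = πmin-nonZero ergodic stationary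
  p : ℚ
  p = πmin π
  e : ℕ → Vector ℚ N
  e = discrepancy stochastic R χ₀
  0<p : 0ℚ < p
  0<p with i , eq ← minimum-attained π = subst (0ℚ <_) (sym eq) (π-pos ergodic stationary i)
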